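{- For every integer $l \ge 1$, the 2-domination numbers of the fractal cubic networks satisfy $\gamma_2(FCN(l)) = 4\,\gamma_2(FCN(l-1))$.
   Context: Fractal cubic network: for an integer $l\ge 0$, $FCN(l)$ is the finite simple graph whose vertices are all binary strings of length $2l+2$, defined recursively as follows. $FCN(0)$ is the 4-cycle with vertices $00, 01, 11, 10$ in this cyclic order. For $l\ge 1$, $FCN(l)$ is obtained from the disjoint union of the four copies $ab\,\Vert\,FCN(l-1)$, $a,b\in\{0,1\}$ (each vertex string of $FCN(l-1)$ is prefixed by $ab$, adjacency inside a copy being that of $FCN(l-1)$), by adding the four edges $\{00w,10w\}$, $\{10w,11w\}$, $\{11w,01w\}$, $\{01w,00w\}$, where $w=10(01)^{l-1}$ is the string $10$ followed by $l-1$ repetitions of $01$. A 2-dominating set of a graph $\Gamma$ is a set $D\subseteq V(\Gamma)$ such that $|N(v)\cap D|\ge 2$ for every $v\in V(\Gamma)\setminus D$, where $N(v)$ is the open neighborhood of $v$; $\gamma_2(\Gamma)$ is the minimum size of a 2-dominating set. -}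

module Defs where

open import Data.Bool.Base using (Bool; true; false; T; _∧_)
open import Data.Bool.Properties using (T?) renaming (_≟_ to _≟ᴮ_)
open import Data.Empty using (⊥-elim)
import Data.Fin.Subset as Fin
open import Data.Fin.Subset.Properties using (anySubset?)
open import Data.List.Base using (List; []; _∷_; length; filterᵇ; lookup; cartesianProductWith)
open import Data.List.Membership.Propositional using (_∈_)
open import Data.List.Membership.Propositional.Properties using (∈-cartesianProductWith⁺)
import Data.List.Membership.DecPropositional as DecMembership
open import Data.List.Properties using (filter-≐)
open import Data.List.Relation.Unary.All as All using (All; []; _∷_)
open import Data.List.Relation.Unary.AllPairs using ([]; _∷_)
open import Data.List.Relation.Unary.Any as Any using (here; there)
open import Data.List.Relation.Unary.Any.Properties using (lookup-index)
open import Data.List.Relation.Unary.Unique.Propositional using (Unique)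
open import Data.List.Relation.Unary.Unique.Propositional.Properties using (cartesianProductWith⁺)
open import Data.Nat.Base using (ℕ; zero; suc; _+_; _*_; _≤_; z≤n)
open import Data.Nat.Properties using (_≤?_; ≤-trans; ≤-refl; ≰⇒>)
open import Data.Product.Base using (_×_; _,_; ∃; proj₁; proj₂)
import Data.Product.Properties as Product
open import Data.Sum.Base using (_⊎_; inj₁; inj₂)
open import Data.Unit.Base using (tt)
open import Data.Vec.Base as Vec using (Vec; []; _∷_; concat; replicate; tabulate)
open import Data.Vec.Properties as Vec using (∷-injective; lookup∘tabulate)
open import Function.Base using (_∘_)
open import Level using (0ℓ)
open import Relation.Binary.Construct.Closure.Symmetric using (SymClosure; fwd; bwd; symmetric)
open import Relation.Binary.Core using (Rel)
open import Relation.Binary.Definitions using (Decidable; Symmetric)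
open import Relation.Binary.PropositionalEquality
  using (_≡_; refl; sym; trans; cong; subst; _≗_)
open import Relation.Nullary using (¬_; Dec; yes; no; does)
open import Relation.Nullary.Decidable using (map′; ¬?; _×-dec_; _⊎-dec_; _→-dec_)

------------------------------------------------------------------------
-- Finite simple graphs

record FiniteSimpleGraph : Set₁ where
  infix 4 _~_ _~?_
  field
    Vertex   : Set
    vertices : List Vertex
    complete : ∀ v → v ∈ vertices
    unique   : Unique vertices
    _~_      : Rel Vertex 0ℓ
    _~?_     : Decidable _~_
    ~-sym    : Symmetric _~_
    ~-irrefl : ∀ {v} → ¬ (v ~ v)

------------------------------------------------------------------------
-- 2-domination

module _ (G : FiniteSimpleGraph) where
  open FiniteSimpleGraph G

  -- Sets of vertices, by their characteristic functions.
  VertexSet : Set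
  VertexSet = Vertex → Bool

  card : VertexSet → ℕ
  card S = length (filterᵇ S vertices)

  infixr 7 _∩_
  _∩_ : VertexSet → VertexSet → VertexSet
  (S ∩ S′) v = S v ∧ S′ v

  N : Vertex → VertexSet
  N v u = does (v ~? u)

  Is2Dominating : VertexSet → Set
  Is2Dominating D = ∀ v → ¬ T (D v) → 2 ≤ card (N v ∩ D)

  Is2DominationNumber : ℕ → Set
  Is2DominationNumber k =
    (∃ λ D → Is2Dominating D × card D ≡ k) ×
    (∀ D → Is2Dominating D → k ≤ card D)

  private
    card-cong : ∀ {S S′} → S ≗ S′ → card S ≡ card S′
    card-cong {S} {S′} eq = cong length
      (filter-≐ (T? ∘ S) (T? ∘ S′)
        ((λ {x} → subst T (eq x)) , (λ {x} → subst T (sym (eq x)))) vertices)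

    Is2Dominating-cong : ∀ {S S′} → S ≗ S′ → Is2Dominating S → Is2Dominating S′
    Is2Dominating-cong eq dom v v∉S′ = subst (2 ≤_)
      (card-cong (λ u → cong (N v u ∧_) (eq u)))
      (dom v (v∉S′ ∘ subst T (eq v)))

    Is2Dominating? : ∀ D → Dec (Is2Dominating D)
    Is2Dominating? D = map′
      (λ all v → All.lookup all (complete v))
      (λ dom → All.tabulate (λ {v} _ → dom v))
      (All.all? (λ v → ¬? (T? (D v)) →-dec (2 ≤? card (N v ∩ D))) vertices)

    fromSubset : Fin.Subset (length vertices) → VertexSet
    fromSubset p v = Vec.lookup p (Any.index (complete v))

    toSubset : VertexSet → Fin.Subset (length vertices)
    toSubset S = tabulate (S ∘ lookup vertices)

    fromSubset∘toSubset : ∀ S → S ≗ fromSubset (toSubset S)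
    fromSubset∘toSubset S v = sym (trans
      (lookup∘tabulate (S ∘ lookup vertices) (Any.index (complete v)))
      (cong S (sym (lookup-index (complete v)))))

    2DominatingOfCard≤ : ℕ → Set
    2DominatingOfCard≤ k = ∃ λ D → Is2Dominating D × card D ≤ k

    2DominatingOfCard≤? : ∀ k → Dec (2DominatingOfCard≤ k)
    2DominatingOfCard≤? k = map′
      (λ (p , good) → fromSubset p , good)
      (λ (D , dom , D≤k) → let eq = fromSubset∘toSubset D in
        toSubset D , Is2Dominating-cong eq dom , subst (_≤ k) (card-cong eq) D≤k)
      (anySubset? (λ p → Is2Dominating? (fromSubset p) ×-dec (card (fromSubset p) ≤? k)))

    descend : ∀ k → 2DominatingOfCard≤ k → ∃ Is2DominationNumber
    descend zero (D , dom , D≤0) =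
      card D , (D , dom , refl) , λ _ _ → ≤-trans D≤0 z≤n
    descend (suc k) (D , dom , D≤1+k) with 2DominatingOfCard≤? k
    ... | yes smaller = descend k smaller
    ... | no ¬smaller = card D , (D , dom , refl) ,
      λ D′ dom′ → ≤-trans D≤1+k (≰⇒> (λ D′≤k → ¬smaller (D′ , dom′ , D′≤k)))

  -- Abstract so that γ₂ is never evaluated by exhaustive search; clients use γ₂-spec.
  abstract
    2DominationNumber-exists : ∃ Is2DominationNumber
    2DominationNumber-exists =
      descend (card V) (V , (λ _ v∉V → ⊥-elim (v∉V tt)) , ≤-refl)
      where
      V : VertexSet
      V _ = true

  γ₂ : ℕ
  γ₂ = proj₁ 2DominationNumber-exists

  γ₂-spec : Is2DominationNumber γ₂
  γ₂-spec = proj₂ 2DominationNumber-exists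

------------------------------------------------------------------------
-- Binary strings

BitString : ℕ → Set
BitString = Vec Bool

pattern 𝟎 = false
pattern 𝟏 = true

_≟_ : ∀ {n} → Decidable (_≡_ {A = BitString n})
_≟_ = Vec.≡-dec _≟ᴮ_

bitStrings : ∀ n → List (BitString n)
bitStrings zero    = [] ∷ []
bitStrings (suc n) = cartesianProductWith _∷_ (𝟎 ∷ 𝟏 ∷ []) (bitStrings n)

bitStrings-complete : ∀ {n} (s : BitString n) → s ∈ bitStrings n
bitStrings-complete []      = here refl
bitStrings-complete (b ∷ s) = ∈-cartesianProductWith⁺ _∷_ (bit b) (bitStrings-complete s)
  where
  bit : ∀ b → b ∈ 𝟎 ∷ 𝟏 ∷ []
  bit 𝟎 = here refl
  bit 𝟏 = there (here refl)

bitStrings-unique : ∀ n → Unique (bitStrings n)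
bitStrings-unique zero    = [] ∷ []
bitStrings-unique (suc n) =
  cartesianProductWith⁺ _∷_ ∷-injective (((λ ()) ∷ []) ∷ [] ∷ []) (bitStrings-unique n)

------------------------------------------------------------------------
-- Fractal cubic networks

-- The length is written 2 + l * 2 so that the length for suc l reduces to
-- two more than the length for l.
FCNVertex : ℕ → Set
FCNVertex l = BitString (2 + l * 2)

edges₀ : List (BitString 2 × BitString 2)
edges₀ = (𝟎 ∷ 𝟎 ∷ [] , 𝟎 ∷ 𝟏 ∷ [])
       ∷ (𝟎 ∷ 𝟏 ∷ [] , 𝟏 ∷ 𝟏 ∷ [])
       ∷ (𝟏 ∷ 𝟏 ∷ [] , 𝟏 ∷ 𝟎 ∷ [])
       ∷ (𝟏 ∷ 𝟎 ∷ [] , 𝟎 ∷ 𝟎 ∷ [])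
       ∷ []

-- The prefixes (ab , cd) of the added edges {abw , cdw}.
links : List (BitString 2 × BitString 2)
links = (𝟎 ∷ 𝟎 ∷ [] , 𝟏 ∷ 𝟎 ∷ [])
      ∷ (𝟏 ∷ 𝟎 ∷ [] , 𝟏 ∷ 𝟏 ∷ [])
      ∷ (𝟏 ∷ 𝟏 ∷ [] , 𝟎 ∷ 𝟏 ∷ [])
      ∷ (𝟎 ∷ 𝟏 ∷ [] , 𝟎 ∷ 𝟎 ∷ [])
      ∷ []

-- 10(01)ˡ, the vertex of FCN l at which its copies are linked inside FCN (suc l).
w : ∀ l → FCNVertex l
w l = 𝟏 ∷ 𝟎 ∷ concat (replicate l (𝟎 ∷ 𝟏 ∷ []))

-- Each edge with one chosen orientation.
Edge : ∀ l → Rel (FCNVertex l) 0ℓ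
Edge zero    u v = (u , v) ∈ edges₀
Edge (suc l) (a ∷ b ∷ u) (c ∷ d ∷ v) =
  ((a ≡ c × b ≡ d) × Edge l u v) ⊎
  ((a ∷ b ∷ [] , c ∷ d ∷ []) ∈ links × u ≡ w l × v ≡ w l)

Adjacent : ∀ l → Rel (FCNVertex l) 0ℓ
Adjacent l = SymClosure (Edge l)

module _ where
  open DecMembership (Product.≡-dec (_≟_ {2}) (_≟_ {2})) using (_∈?_)

  Edge? : ∀ l → Decidable (Edge l)
  Edge? zero    u v = (u , v) ∈? edges₀
  Edge? (suc l) (a ∷ b ∷ u) (c ∷ d ∷ v) =
    (((a ≟ᴮ c) ×-dec (b ≟ᴮ d)) ×-dec Edge? l u v) ⊎-dec
    (((a ∷ b ∷ [] , c ∷ d ∷ []) ∈? links) ×-dec ((u ≟ w l) ×-dec (v ≟ w l)))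

Adjacent? : ∀ l → Decidable (Adjacent l)
Adjacent? l u v = map′ to from (Edge? l u v ⊎-dec Edge? l v u)
  where
  to : Edge l u v ⊎ Edge l v u → Adjacent l u v
  to (inj₁ e) = fwd e
  to (inj₂ e) = bwd e
  from : Adjacent l u v → Edge l u v ⊎ Edge l v u
  from (fwd e) = inj₁ e
  from (bwd e) = inj₂ e

Edge-irrefl : ∀ l {v} → ¬ Edge l v v
Edge-irrefl zero (here ())
Edge-irrefl zero (there (here ()))
Edge-irrefl zero (there (there (here ())))
Edge-irrefl zero (there (there (there (here ()))))
Edge-irrefl (suc l) {a ∷ b ∷ v} (inj₁ (_ , e)) = Edge-irrefl l e
Edge-irrefl (suc l) {a ∷ b ∷ v} (inj₂ (here () , _))
Edge-irrefl (suc l) {a ∷ b ∷ v} (inj₂ (there (here ()) , _))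
Edge-irrefl (suc l) {a ∷ b ∷ v} (inj₂ (there (there (here ())) , _))
Edge-irrefl (suc l) {a ∷ b ∷ v} (inj₂ (there (there (there (here ()))) , _))

Adjacent-irrefl : ∀ l {v} → ¬ Adjacent l v v
Adjacent-irrefl l (fwd e) = Edge-irrefl l e
Adjacent-irrefl l (bwd e) = Edge-irrefl l e

FCN : ℕ → FiniteSimpleGraph
FCN l = record
  { Vertex   = FCNVertex l
  ; vertices = bitStrings (2 + l * 2)
  ; complete = bitStrings-complete
  ; unique   = bitStrings-unique (2 + l * 2)
  ; _~_      = Adjacent l
  ; _~?_     = Adjacent? l
  ; ~-sym    = symmetric (Edge l)
  ; ~-irrefl = Adjacent-irrefl l
  }

{-# OPTIONS --safe #-}
-- Call a vertex odd if its last two bits differ. The vertex w l is odd, so the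
-- added edges only ever touch odd vertices, and an even vertex is adjacent
-- exactly to the two odd vertices of its own 4-cycle. Hence the odd vertices
-- form a 2-dominating set, with two vertices in each of the 4ˡ copies of
-- FCN 0. Conversely, a 2-dominating set missing an odd vertex of such a copy
-- contains both even ones, so it has at least two vertices in every copy.
module Submission where

open import Defs
open import Data.Bool.Base using (Bool; true; false; T; _∧_; _xor_)
open import Data.Bool.Properties using (T?)
open import Data.Empty using (⊥-elim)
open import Data.List.Base using (List; []; _∷_; _++_; length; filterᵇ; map)
open import Data.List.Properties using (length-++; filter-++; ++-identityʳ)
open import Data.Nat.Base using (ℕ; zero; suc; _≥_; _≤_; _+_; _*_; _∸_; _^_; z≤n; s≤s)
open import Data.Nat.Properties
  using (≤-antisym; ≤-pred; n≮0; +-mono-≤; +-assoc; +-identityʳ; *-assoc; module ≤-Reasoning)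
open import Data.Product.Base using (_×_; _,_)
open import Data.Sum.Base using (inj₁; inj₂)
open import Data.Unit.Base using (tt)
open import Data.Vec.Base using ([]; _∷_; concat; replicate)
open import Function.Base using (_∘_)
open import Function.Bundles using (mk⇔)
open import Relation.Binary.Construct.Closure.Symmetric using (fwd; bwd)
open import Relation.Binary.PropositionalEquality
  using (_≡_; _≢_; refl; sym; trans; cong; cong₂; subst; _≗_; module ≡-Reasoning)
open import Relation.Nullary using (¬_)
open import Relation.Nullary.Decidable using (dec-false; does-⇔)

-- Since `γ₂` is abstract, its value can only be identified through `γ₂-spec`: each minimum is at
-- most the size of the other's witness.
Is2DominationNumber-unique : ∀ G {j k} →
  Is2DominationNumber G j → Is2DominationNumber G k → j ≡ k
Is2DominationNumber-unique G ((D , dom , refl) , min) ((D′ , dom′ , refl) , min′) =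
  ≤-antisym (min D′ dom′) (min′ D dom)

module _ {A : Set} where

  countᵇ : (A → Bool) → List A → ℕ
  countᵇ p xs = length (filterᵇ p xs)

  countᵇ-++ : ∀ p xs ys → countᵇ p (xs ++ ys) ≡ countᵇ p xs + countᵇ p ys
  countᵇ-++ p xs ys = trans (cong length (filter-++ (T? ∘ p) xs ys))
    (length-++ (filterᵇ p xs))

  countᵇ-cong : ∀ {p q} → p ≗ q → ∀ xs → countᵇ p xs ≡ countᵇ q xs
  countᵇ-cong         eq []       = refl
  countᵇ-cong {p} {q} eq (x ∷ xs) with p x | q x | eq x
  ... | true  | _ | refl = cong suc (countᵇ-cong eq xs)
  ... | false | _ | refl = countᵇ-cong eq xs

  countᵇ-none : ∀ {p} → (∀ x → p x ≡ false) → ∀ xs → countᵇ p xs ≡ 0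
  countᵇ-none     none []       = refl
  countᵇ-none {p} none (x ∷ xs) with p x | none x
  ... | false | refl = countᵇ-none none xs

countᵇ-map : ∀ {A B : Set} (p : B → Bool) (f : A → B) xs →
  countᵇ p (map f xs) ≡ countᵇ (p ∘ f) xs
countᵇ-map p f []       = refl
countᵇ-map p f (x ∷ xs) with p (f x)
... | true  = cong suc (countᵇ-map p f xs)
... | false = countᵇ-map p f xs

count : ∀ n → (BitString n → Bool) → ℕ
count n S = countᵇ S (bitStrings n)

count-suc : ∀ n S → count (suc n) S ≡ count n (S ∘ (𝟎 ∷_)) + count n (S ∘ (𝟏 ∷_))
count-suc n S = begin
  countᵇ S (map (𝟎 ∷_) xs ++ map (𝟏 ∷_) xs ++ [])
    ≡⟨ cong (λ ys → countᵇ S (map (𝟎 ∷_) xs ++ ys)) (++-identityʳ (map (𝟏 ∷_) xs)) ⟩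
  countᵇ S (map (𝟎 ∷_) xs ++ map (𝟏 ∷_) xs)
    ≡⟨ countᵇ-++ S (map (𝟎 ∷_) xs) (map (𝟏 ∷_) xs) ⟩
  countᵇ S (map (𝟎 ∷_) xs) + countᵇ S (map (𝟏 ∷_) xs)
    ≡⟨ cong₂ _+_ (countᵇ-map S (𝟎 ∷_) xs) (countᵇ-map S (𝟏 ∷_) xs) ⟩
  countᵇ (S ∘ (𝟎 ∷_)) xs + countᵇ (S ∘ (𝟏 ∷_)) xs ∎
  where
  open ≡-Reasoning
  xs = bitStrings n

count-supported : ∀ n S b → (∀ c v → b ≢ c → S (c ∷ v) ≡ false) →
  count (suc n) S ≡ count n (S ∘ (b ∷_))
count-supported n S 𝟎 off = trans (count-suc n S)
  (trans (cong (count n (S ∘ (𝟎 ∷_)) +_) (countᵇ-none (λ v → off 𝟏 v λ ()) (bitStrings n)))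
         (+-identityʳ _))
count-supported n S 𝟏 off = trans (count-suc n S)
  (cong (_+ count n (S ∘ (𝟏 ∷_))) (countᵇ-none (λ v → off 𝟎 v λ ()) (bitStrings n)))

restrict : ∀ {n} → Bool → Bool → (BitString (2 + n) → Bool) → BitString n → Bool
restrict a b S v = S (a ∷ b ∷ v)

-- The nesting and the final `+ 0` copy the unfolding of `4 * m`, so four equal summands give
-- `4 * m` definitionally.
count-quarters : ∀ n S → count (2 + n) S ≡
  count n (restrict 𝟎 𝟎 S) + (count n (restrict 𝟎 𝟏 S) +
  (count n (restrict 𝟏 𝟎 S) + (count n (restrict 𝟏 𝟏 S) + 0)))
count-quarters n S = begin
  count (2 + n) S
    ≡⟨ count-suc (suc n) S ⟩
  count (suc n) (S ∘ (𝟎 ∷_)) + count (suc n) (S ∘ (𝟏 ∷_))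
    ≡⟨ cong₂ _+_ (count-suc n (S ∘ (𝟎 ∷_))) (count-suc n (S ∘ (𝟏 ∷_))) ⟩
  (k 𝟎 𝟎 + k 𝟎 𝟏) + (k 𝟏 𝟎 + k 𝟏 𝟏)
    ≡⟨ +-assoc (k 𝟎 𝟎) _ _ ⟩
  k 𝟎 𝟎 + (k 𝟎 𝟏 + (k 𝟏 𝟎 + k 𝟏 𝟏))
    ≡⟨ cong (λ m → k 𝟎 𝟎 + (k 𝟎 𝟏 + (k 𝟏 𝟎 + m))) (+-identityʳ (k 𝟏 𝟏)) ⟨
  k 𝟎 𝟎 + (k 𝟎 𝟏 + (k 𝟏 𝟎 + (k 𝟏 𝟏 + 0))) ∎
  where
  open ≡-Reasoning
  k : Bool → Bool → ℕ
  k a b = count n (restrict a b S)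

-- Recursion on `l` discards the copy prefix, so `restrict a b (odd (suc l))` reduces to `odd l`.
odd : ∀ l → FCNVertex l → Bool
odd zero    (a ∷ b ∷ []) = a xor b
odd (suc l) (a ∷ b ∷ v)  = odd l v

Even : ∀ l → FCNVertex l → Set
Even l v = ¬ T (odd l v)

odd-w : ∀ l → T (odd l (w l))
odd-w = go 𝟏 𝟎 tt
  where
  -- Dropping the leading pair of `w (suc l)` leaves a string headed by 01, not `w l`; the induction
  -- therefore runs over any leading pair of distinct bits.
  go : ∀ a b → T (a xor b) → ∀ l → T (odd l (a ∷ b ∷ concat (replicate l (𝟎 ∷ 𝟏 ∷ []))))
  go a b a≢b zero    = a≢b
  go a b a≢b (suc l) = go 𝟎 𝟏 tt l

even≢w : ∀ l {v} → Even l v → v ≢ w l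
even≢w l even refl = even (odd-w l)

even-adjacent : ∀ l {a b c d v u} → Even l v →
  Adjacent (suc l) (a ∷ b ∷ v) (c ∷ d ∷ u) → (a ≡ c × b ≡ d) × Adjacent l v u
even-adjacent l even (fwd (inj₁ (eqs , e)))             = eqs , fwd e
even-adjacent l even (fwd (inj₂ (_ , v≡w , _)))         = ⊥-elim (even≢w l even v≡w)
even-adjacent l even (bwd (inj₁ ((refl , refl) , e)))   = (refl , refl) , bwd e
even-adjacent l even (bwd (inj₂ (_ , _ , v≡w)))         = ⊥-elim (even≢w l even v≡w)

adjacent-copy : ∀ l {a b v u} → Adjacent l v u → Adjacent (suc l) (a ∷ b ∷ v) (a ∷ b ∷ u)
adjacent-copy l (fwd e) = fwd (inj₁ ((refl , refl) , e))
adjacent-copy l (bwd e) = bwd (inj₁ ((refl , refl) , e))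

-- The inductive step of both bounds. By `even-adjacent` all neighbours carry the prefix `a`, `b`,
-- so the count is cut down one prefix bit at a time, and inside the copy the two adjacencies agree.
even-neighbours : ∀ l a b v → Even l v → (D : VertexSet (FCN (suc l))) →
  card (FCN (suc l)) (_∩_ (FCN (suc l)) (N (FCN (suc l)) (a ∷ b ∷ v)) D) ≡
  card (FCN l) (_∩_ (FCN l) (N (FCN l) v) (restrict a b D))
even-neighbours l a b v even D = begin
  count (4 + l * 2) S
    ≡⟨ count-supported (3 + l * 2) S a (λ { c (d ∷ u) a≢c →
         nonadjacent λ e → let ((a≡c , _) , _) = even-adjacent l even e in a≢c a≡c }) ⟩
  count (3 + l * 2) (S ∘ (a ∷_))
    ≡⟨ count-supported (2 + l * 2) (S ∘ (a ∷_)) b (λ d u b≢d →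
         nonadjacent λ e → let ((_ , b≡d) , _) = even-adjacent l even e in b≢d b≡d) ⟩
  count (2 + l * 2) (restrict a b S)
    ≡⟨ countᵇ-cong (λ u → cong (_∧ D (a ∷ b ∷ u)) (does-⇔
         (mk⇔ (λ e → let (_ , e′) = even-adjacent l even e in e′) (adjacent-copy l))
         (Adjacent? (suc l) (a ∷ b ∷ v) (a ∷ b ∷ u)) (Adjacent? l v u)))
         (bitStrings (2 + l * 2)) ⟩
  count (2 + l * 2) (_∩_ (FCN l) (N (FCN l) v) (restrict a b D)) ∎
  where
  open ≡-Reasoning
  S : VertexSet (FCN (suc l))
  S = _∩_ (FCN (suc l)) (N (FCN (suc l)) (a ∷ b ∷ v)) D

  nonadjacent : ∀ {u} → ¬ Adjacent (suc l) (a ∷ b ∷ v) u → S u ≡ false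
  nonadjacent {u} ¬e =
    cong (_∧ D u) (dec-false (Adjacent? (suc l) (a ∷ b ∷ v) u) ¬e)

-- Unlike `Is2Dominating`, this condition passes to the copies: a restricted set may fail at `w l`,
-- which can be dominated through added edges, but even vertices keep all their neighbours.
Dominates2Even : ∀ l → VertexSet (FCN l) → Set
Dominates2Even l D = ∀ v → Even l v → ¬ T (D v) →
  2 ≤ card (FCN l) (_∩_ (FCN l) (N (FCN l) v) D)

-- Lying outside `odd l` is literally `Even l`, so `even-neighbours` covers every vertex to be
-- checked.
odd-2dominating : ∀ l → Is2Dominating (FCN l) (odd l)
odd-2dominating zero    (𝟎 ∷ 𝟎 ∷ []) _    = s≤s (s≤s z≤n)
odd-2dominating zero    (𝟎 ∷ 𝟏 ∷ []) even = ⊥-elim (even tt)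
odd-2dominating zero    (𝟏 ∷ 𝟎 ∷ []) even = ⊥-elim (even tt)
odd-2dominating zero    (𝟏 ∷ 𝟏 ∷ []) _    = s≤s (s≤s z≤n)
odd-2dominating (suc l) (a ∷ b ∷ v)  even =
  subst (2 ≤_) (sym (even-neighbours l a b v even (odd (suc l)))) (odd-2dominating l v even)

card-odd : ∀ l → card (FCN l) (odd l) ≡ 4 ^ l * 2
card-odd zero    = refl
card-odd (suc l) = begin
  card (FCN (suc l)) (odd (suc l)) ≡⟨ count-quarters (2 + l * 2) (odd (suc l)) ⟩
  4 * card (FCN l) (odd l)         ≡⟨ cong (4 *_) (card-odd l) ⟩
  4 * (4 ^ l * 2)                  ≡⟨ *-assoc 4 (4 ^ l) 2 ⟨
  4 ^ suc l * 2                    ∎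
  where open ≡-Reasoning

card-lower-bound : ∀ l D → Dominates2Even l D → 4 ^ l * 2 ≤ card (FCN l) D
-- Both facts are bound before `D` is split, so that each split refines their types too. If 00 is
-- missing, 01 and 10 must both be present; if 00 is present, only the set {00} has fewer than two
-- elements, and it fails at 11.
card-lower-bound zero D dom with dom (𝟎 ∷ 𝟎 ∷ []) (λ ()) | dom (𝟏 ∷ 𝟏 ∷ []) (λ ())
... | dom₀₀ | dom₁₁ with D (𝟎 ∷ 𝟎 ∷ [])
card-lower-bound zero D dom | dom₀₀ | dom₁₁ | 𝟎 with D (𝟎 ∷ 𝟏 ∷ [])
... | 𝟏 with D (𝟏 ∷ 𝟎 ∷ [])
...   | 𝟏 = s≤s (s≤s z≤n)
...   | 𝟎 = ⊥-elim (n≮0 (≤-pred (dom₀₀ λ ())))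
card-lower-bound zero D dom | dom₀₀ | dom₁₁ | 𝟎 | 𝟎 with D (𝟏 ∷ 𝟎 ∷ [])
... | 𝟏 = ⊥-elim (n≮0 (≤-pred (dom₀₀ λ ())))
... | 𝟎 = ⊥-elim (n≮0 (dom₀₀ λ ()))
card-lower-bound zero D dom | dom₀₀ | dom₁₁ | 𝟏 with D (𝟎 ∷ 𝟏 ∷ [])
... | 𝟏 = s≤s (s≤s z≤n)
... | 𝟎 with D (𝟏 ∷ 𝟎 ∷ [])
...   | 𝟏 = s≤s (s≤s z≤n)
...   | 𝟎 with D (𝟏 ∷ 𝟏 ∷ [])
...     | 𝟏 = s≤s (s≤s z≤n)
...     | 𝟎 = ⊥-elim (n≮0 (dom₁₁ λ ()))
card-lower-bound (suc l) D dom = begin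
  4 ^ suc l * 2    ≡⟨ *-assoc 4 (4 ^ l) 2 ⟩
  4 * (4 ^ l * 2)  ≤⟨ +-mono-≤ (quarter 𝟎 𝟎) (+-mono-≤ (quarter 𝟎 𝟏)
                        (+-mono-≤ (quarter 𝟏 𝟎) (+-mono-≤ (quarter 𝟏 𝟏) z≤n))) ⟩
  _                ≡⟨ count-quarters (2 + l * 2) D ⟨
  card (FCN (suc l)) D ∎
  where
  open ≤-Reasoning
  quarter : ∀ a b → 4 ^ l * 2 ≤ card (FCN l) (restrict a b D)
  quarter a b = card-lower-bound l (restrict a b D) λ v even v∉D →
    subst (2 ≤_) (even-neighbours l a b v even D) (dom (a ∷ b ∷ v) even v∉D)

γ₂-FCN : ∀ l → γ₂ (FCN l) ≡ 4 ^ l * 2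
γ₂-FCN l = Is2DominationNumber-unique (FCN l) (γ₂-spec (FCN l))
  ( (odd l , odd-2dominating l , card-odd l)
  , λ D dom → card-lower-bound l D (λ v _ → dom v))

theorem26 : (l : ℕ) → l ≥ 1 → γ₂ (FCN l) ≡ 4 * γ₂ (FCN (l ∸ 1))
theorem26 (suc l) _ = begin
  γ₂ (FCN (suc l))  ≡⟨ γ₂-FCN (suc l) ⟩
  4 ^ suc l * 2     ≡⟨ *-assoc 4 (4 ^ l) 2 ⟩
  4 * (4 ^ l * 2)   ≡⟨ cong (4 *_) (γ₂-FCN l) ⟨
  4 * γ₂ (FCN l)    ∎
  where open ≡-Reasoning
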